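{- Suppose $\mathbb K$ is a computable age with the amalgamation property (AP). Then $\mathbb K$ has the $\mathscr{EI}(\mathbb K)$-computable amalgamation property; that is, there is a function, computable from the embedding information $\mathscr{EI}(\mathbb K)$, which maps each potential span in $\mathbb K$ to an amalgamation diagram over it.
   Context: Languages and structures. $\mathcal{L}$ is a countable language (relation symbols of positive arity; function symbols of any arity, 0-ary ones being constants) with a computable representation: relation symbols $R_n$ and function symbols $F_m$ are indexed bijectively by disjoint computable subsets of $\omega$, with arity computable from the index. An $\mathcal{L}$-structure $\mathcal{M}$ is c.e. if its underlying set $M$ is a c.e. subset of $\omega$ and the sets $\{(n,\mathbf a): \mathcal M\models R_n(\mathbf a)\}$, $\{(n,\mathbf a): \mathcal M\models \neg R_n(\mathbf a)\}$, $\{(m,\mathbf a,b): \mathcal M\models F_m(\mathbf a)=b\}$ are c.e.; it is computable if moreover $M$ is computable. Tuples are finite; $\mathrm{cl}_{\mathcal M}(\mathbf a)$ is the smallest substructure of $\mathcal M$ containing $\mathbf a$. For $\mathbf a\in\mathcal A$, $\mathbf b\in\mathcal B$ of the same length, $\mathbf a\simeq\mathbf b$ means that for every atomic $\mathcal L$-formula $\varphi$, $\mathcal A\models\varphi(\mathbf a)$ iff $\mathcal B\models\varphi(\mathbf b)$; equivalently $\mathbf a\mapsto\mathbf b$ extends to an isomorphism $\mathrm{cl}(\mathbf a)\to\mathrm{cl}(\mathbf b)$. Ages. An age is a collection of finitely generated $\mathcal L$-structures closed under isomorphism. A computable age (computable representation of an age $\mathcal K$) is a c.e. set $\mathbb K$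 of triples $(\mathbf a,\mathcal A,i)$ (computable structures being given by indices), with exactly one triple for each $i\in\omega$, written $\mathbb I(i)=(\mathbf a_i,\mathcal A_i,i)$, such that each $\mathcal A_i$ is a computable $\mathcal L$-structure in $\mathcal K$ with $\mathcal A_i=\mathrm{cl}_{\mathcal A_i}(\mathbf a_i)$, and every $\mathcal B\in\mathcal K$ is isomorphic to some $\mathcal A_i$. $\mathbb K$ is said to have a property of ages if $\mathcal K$ does. The embedding information $\mathscr{EI}(\mathbb K)$ is the set of tuples $(\mathbb I(k_0),\mathbf b_0,\mathbb I(k_1),\mathbf b_1)$ with $\mathbf b_0\in\mathcal A_{k_0}$, $\mathbf b_1\in\mathcal A_{k_1}$ and $\mathbf b_0\simeq\mathbf b_1$. (AP): for all $\mathcal A,\mathcal B,\mathcal C\in\mathcal K$ and embeddings $f_{\mathcal B}:\mathcal A\to\mathcal B$, $f_{\mathcal C}:\mathcal A\to\mathcal C$ there are $\mathcal D\in\mathcal K$ and embeddings $\alpha_{\mathcal B}:\mathcal B\to\mathcal D$, $\alpha_{\mathcal C}:\mathcal C\to\mathcal D$ with $\alpha_{\mathcal B}\circ f_{\mathcal B}=\alpha_{\mathcal C}\circ f_{\mathcal C}$. Embeddings and amalgamation diagrams. A potential embedding in $\mathbb K$ is a triple $F=(\mathbb I(i),\mathbb I(j),\mathbf c)$ with $\mathbf c\in\mathcal A_j$; $\mathrm{dom}(F)=\mathbb I(i)$, $\mathrm{codom}(F)=\mathbb I(j)$. It is an embedding if $\mathbf a_i\simeq\mathbf c$ (it then encodes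 the embedding $\mathcal A_i\to\mathcal A_j$ sending $\mathbf a_i$ to $\mathbf c$); composition of embeddings is composition of the encoded maps. A potential span is a pair $(F_0,F_1)$ of potential embeddings with $\mathrm{dom}(F_0)=\mathrm{dom}(F_1)$; it is a span if both are embeddings. An amalgamation diagram over a potential span $(F_0,F_1)$ is a pair $(G_0,G_1)$ with $G_0$ an embedding, $G_1$ a potential embedding, $\mathrm{dom}(G_i)=\mathrm{codom}(F_i)$ for $i\in\{0,1\}$, $\mathrm{codom}(G_0)=\mathrm{codom}(G_1)$, and such that if $(F_0,F_1)$ is a span then $G_1$ is an embedding and $G_0\circ F_0=G_1\circ F_1$. -}

module Defs where

open import Level using (Level; 0ℓ) renaming (suc to lsuc; _⊔_ to _⊔ˡ_)
open import Data.Bool.Base using (Bool; true; false; T; if_then_else_)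
open import Data.Nat.Base using (ℕ; zero; suc; _+_; _<_)
open import Data.Fin.Base using (Fin; toℕ; cast)
open import Data.Vec.Base as Vec using (Vec; []; _∷_)
open import Data.Vec.Functional using (Vector)
open import Data.List.Base as List using (List; []; _∷_)
open import Data.Product.Base using (Σ; ∃; ∃-syntax; Σ-syntax; _×_; _,_; proj₁; proj₂)
open import Data.Sum.Base using (_⊎_)
open import Function.Base using (_∘_)
open import Function.Bundles using (_⇔_; mk⇔; Equivalence)
open import Function.Definitions using (Congruent; Injective; StrictlySurjective)
open import Relation.Nullary.Negation.Core using (¬_)
open import Relation.Unary using (Pred)
open import Relation.Binary.Bundles using (Setoid)
open import Relation.Binary.PropositionalEquality using (_≡_; refl)
import Relation.Binary.PropositionalEquality.Properties as ≡
import Relation.Binary.Construct.On as On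

------------------------------------------------------------------------
-- Coding into ℕ

triangle : ℕ → ℕ
triangle zero    = 0
triangle (suc n) = suc n + triangle n

-- The Cantor pairing bijection ℕ × ℕ → ℕ.
pair : ℕ → ℕ → ℕ
pair x y = triangle (x + y) + y

triple : ℕ → ℕ → ℕ → ℕ
triple x y z = pair x (pair y z)

-- A bijection from finite sequences onto ℕ.
codeList : List ℕ → ℕ
codeList []       = 0
codeList (x ∷ xs) = suc (pair x (codeList xs))

------------------------------------------------------------------------
-- Partial recursive functions relative to an oracle

data Program : ℕ → Set where
  zeroᵖ  : ∀ {n} → Program n
  sucᵖ   : Program 1
  proj   : ∀ {n} → Fin n → Program n
  oracle : Program 1
  comp   : ∀ {m n} → Program m → Vec (Program n) m → Program n
  prec   : ∀ {n} → Program n → Program (2 + n) → Program (suc n)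
  mu     : ∀ {n} → Program (suc n) → Program n

-- χ ⊢ p [ xs ]⇓ y : on input xs, the program p with oracle χ halts with
-- output y.
infix 4 _⊢_[_]⇓_

data _⊢_[_]⇓_ (χ : ℕ → Bool) : ∀ {n} → Program n → Vec ℕ n → ℕ → Set where
  ⇓zero   : ∀ {n} {xs : Vec ℕ n} → χ ⊢ zeroᵖ [ xs ]⇓ 0
  ⇓suc    : ∀ {x} → χ ⊢ sucᵖ [ x ∷ [] ]⇓ suc x
  ⇓proj   : ∀ {n} {xs : Vec ℕ n} (i : Fin n) → χ ⊢ proj i [ xs ]⇓ Vec.lookup xs i
  ⇓oracle : ∀ {x} → χ ⊢ oracle [ x ∷ [] ]⇓ (if χ x then 1 else 0)
  ⇓comp   : ∀ {m n} {p : Program m} {qs : Vec (Program n) m} {xs y} (ys : Vec ℕ m) →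
            (∀ i → χ ⊢ Vec.lookup qs i [ xs ]⇓ Vec.lookup ys i) →
            χ ⊢ p [ ys ]⇓ y →
            χ ⊢ comp p qs [ xs ]⇓ y
  ⇓prec-0 : ∀ {n} {p : Program n} {q : Program (2 + n)} {xs y} →
            χ ⊢ p [ xs ]⇓ y →
            χ ⊢ prec p q [ 0 ∷ xs ]⇓ y
  ⇓prec-s : ∀ {n} {p : Program n} {q : Program (2 + n)} {k xs r y} →
            χ ⊢ prec p q [ k ∷ xs ]⇓ r →
            χ ⊢ q [ k ∷ r ∷ xs ]⇓ y →
            χ ⊢ prec p q [ suc k ∷ xs ]⇓ y
  ⇓mu     : ∀ {n} {p : Program (suc n)} {xs y} →
            (∀ z → z < y → ∃[ w ] χ ⊢ p [ z ∷ xs ]⇓ suc w) →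
            χ ⊢ p [ y ∷ xs ]⇓ 0 →
            χ ⊢ mu p [ xs ]⇓ y

-- Gödel numbering; it is injective on the programs of each fixed arity.
mutual
  ⌜_⌝ : ∀ {n} → Program n → ℕ
  ⌜ zeroᵖ ⌝     = pair 0 0
  ⌜ sucᵖ ⌝      = pair 1 0
  ⌜ proj i ⌝    = pair 2 (toℕ i)
  ⌜ oracle ⌝    = pair 3 0
  ⌜ comp p qs ⌝ = pair 4 (pair ⌜ p ⌝ (codeList ⌜ qs ⌝*))
  ⌜ prec p q ⌝  = pair 5 (pair ⌜ p ⌝ ⌜ q ⌝)
  ⌜ mu p ⌝      = pair 6 ⌜ p ⌝

  ⌜_⌝* : ∀ {m n} → Vec (Program n) m → List ℕ
  ⌜ [] ⌝*     = []
  ⌜ p ∷ ps ⌝* = ⌜ p ⌝ ∷ ⌜ ps ⌝*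

-- Unrelativised computability is computability with the empty oracle.
∅ : ℕ → Bool
∅ _ = false

-- p computes the characteristic function of P.
Decides : Program 1 → Pred ℕ 0ℓ → Set
Decides p P = ∀ n → (P n × ∅ ⊢ p [ n ∷ [] ]⇓ 1) ⊎ (¬ P n × ∅ ⊢ p [ n ∷ [] ]⇓ 0)

-- P is the domain of the partial function computed by p.
Enumerates : Program 1 → Pred ℕ 0ℓ → Set
Enumerates p P = ∀ n → P n ⇔ (∃[ y ] ∅ ⊢ p [ n ∷ [] ]⇓ y)

Computable : Pred ℕ 0ℓ → Set
Computable P = ∃[ p ] Decides p P

CE : Pred ℕ 0ℓ → Set
CE P = ∃[ p ] Enumerates p P

IsCharacteristicFunction : (ℕ → Bool) → Pred ℕ 0ℓ → Set
IsCharacteristicFunction χ P = ∀ n → T (χ n) ⇔ P n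

------------------------------------------------------------------------
-- Languages and structures

-- The two index sets are disjoint, so a single arity function serves both
-- kinds of symbol; its values off the index sets are irrelevant.
record Language : Set where
  field
    isRel isFun      : ℕ → Bool
    disjoint         : ∀ n → ¬ (T (isRel n) × T (isFun n))
    arity            : ℕ → ℕ
    rel-positive     : ∀ n → T (isRel n) → 0 < arity n
    isRel-computable : Computable (T ∘ isRel)
    isFun-computable : Computable (T ∘ isFun)
    arity-computable : Σ[ p ∈ Program 1 ] (∀ n → T (isRel n) ⊎ T (isFun n) →
                                           ∅ ⊢ p [ n ∷ [] ]⇓ arity n)

  RelSym : Set
  RelSym = ∃[ n ] T (isRel n)

  FunSym : Set
  FunSym = ∃[ n ] T (isFun n)

  relArity : RelSym → ℕ
  relArity (n , _) = arity n

  funArity : FunSym → ℕ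
  funArity (n , _) = arity n

open Language public using (RelSym; FunSym; relArity; funArity)

record Interpretation (L : Language) (S : Setoid 0ℓ 0ℓ) : Set₁ where
  open Setoid S using (Carrier; _≈_)
  field
    rel      : (R : RelSym L) → Vector Carrier (relArity L R) → Set
    fun      : (F : FunSym L) → Vector Carrier (funArity L F) → Carrier
    rel-resp : ∀ R {xs ys} → (∀ j → xs j ≈ ys j) → rel R xs → rel R ys
    fun-cong : ∀ F {xs ys} → (∀ j → xs j ≈ ys j) → fun F xs ≈ fun F ys

-- Equality in a structure is the setoid equality.
record Structure (L : Language) : Set₁ where
  field
    setoid : Setoid 0ℓ 0ℓ
    interp : Interpretation L setoid
  open Setoid setoid public
    using (Carrier; _≈_) renaming (refl to ≈-refl; sym to ≈-sym; trans to ≈-trans)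
  open Interpretation interp public

open Structure using (Carrier)

Tuple : Set → Set
Tuple A = ∃[ n ] Vector A n

module _ {L : Language} where

  -- The smallest substructure containing a.
  data cl (A : Structure L) {n} (a : Vector (Carrier A) n) : Carrier A → Set where
    gen  : ∀ i → cl A a (a i)
    app  : ∀ F {xs} → (∀ j → cl A a (xs j)) → cl A a (Structure.fun A F xs)
    resp : ∀ {x y} → Structure._≈_ A x y → cl A a x → cl A a y

  Generates : (A : Structure L) → Tuple (Carrier A) → Set
  Generates A (_ , a) = ∀ x → cl A a x

  FinitelyGenerated : Structure L → Set
  FinitelyGenerated A = ∃[ a ] Generates A a

  record Embedding (A B : Structure L) : Set where
    private
      module A = Structure A
      module B = Structure B
    field
      map       : A.Carrier → B.Carrier
      congruent : Congruent A._≈_ B._≈_ map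
      injective : Injective A._≈_ B._≈_ map
      map-rel   : ∀ R xs → A.rel R xs ⇔ B.rel R (map ∘ xs)
      map-fun   : ∀ F xs → map (A.fun F xs) B.≈ B.fun F (map ∘ xs)

  open Embedding using (map)

  _≅_ : Structure L → Structure L → Set
  A ≅ B = Σ[ f ∈ Embedding A B ] StrictlySurjective (Structure._≈_ B) (map f)

  _∘ᵉ_ : ∀ {A B C : Structure L} → Embedding B C → Embedding A B → Embedding A C
  _∘ᵉ_ {A} {B} {C} g f = record
    { map       = map g ∘ map f
    ; congruent = G.congruent ∘ F.congruent
    ; injective = F.injective ∘ G.injective
    ; map-rel   = λ R xs → mk⇔
        (Equivalence.to (G.map-rel R _) ∘ Equivalence.to (F.map-rel R xs))
        (Equivalence.from (F.map-rel R xs) ∘ Equivalence.from (G.map-rel R _))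
    ; map-fun   = λ H xs →
        Structure.≈-trans C (G.congruent (F.map-fun H xs)) (G.map-fun H _)
    }
    where
    module F = Embedding f
    module G = Embedding g

  _≗ᵉ_ : ∀ {A B : Structure L} → Embedding A B → Embedding A B → Set
  _≗ᵉ_ {A} {B} f g = ∀ x → Structure._≈_ B (map f x) (map g x)

------------------------------------------------------------------------
-- Atomic formulas

module _ (L : Language) where

  data Term (n : ℕ) : Set where
    var : Fin n → Term n
    app : (F : FunSym L) → Vector (Term n) (funArity L F) → Term n

  data Atomic (n : ℕ) : Set where
    pred : (R : RelSym L) → Vector (Term n) (relArity L R) → Atomic n
    _≐_  : Term n → Term n → Atomic n

module _ {L : Language} where

  ⟦_⟧ : ∀ {n} → Term L n → (A : Structure L) → Vector (Carrier A) n → Carrier A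
  ⟦ var i ⟧    A a = a i
  ⟦ app F ts ⟧ A a = Structure.fun A F (λ j → ⟦ ts j ⟧ A a)

  _⊨_[_] : (A : Structure L) → ∀ {n} → Atomic L n → Vector (Carrier A) n → Set
  A ⊨ pred R ts [ a ] = Structure.rel A R (λ j → ⟦ ts j ⟧ A a)
  A ⊨ s ≐ t     [ a ] = Structure._≈_ A (⟦ s ⟧ A a) (⟦ t ⟧ A a)

  Similar : (A B : Structure L) → Tuple (Carrier A) → Tuple (Carrier B) → Set
  Similar A B (m , a) (n , b) =
    Σ[ eq ∈ m ≡ n ] (∀ (φ : Atomic L m) → (A ⊨ φ [ a ]) ⇔ (B ⊨ φ [ b ∘ cast eq ]))

  term : ∀ (A : Structure L) {n} {a : Vector (Carrier A) n} {x} → cl A a x → Term L n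
  term A (gen i)    = var i
  term A (app F ps) = app F (λ j → term A (ps j))
  term A (resp _ p) = term A p

  term-value : ∀ (A : Structure L) {n} {a : Vector (Carrier A) n} {x} (p : cl A a x) →
               Structure._≈_ A (⟦ term A p ⟧ A a) x
  term-value A (gen i)     = Structure.≈-refl A
  term-value A (app F ps)  = Structure.fun-cong A F (λ j → term-value A (ps j))
  term-value A (resp eq p) = Structure.≈-trans A (term-value A p) eq

  -- If A is generated by a and a ≃ b, the embedding A → B sending a to b:
  -- the value of a term at a is sent to the value of that term at b.
  inducedEmbedding : ∀ {A B : Structure L} (a : Tuple (Carrier A)) (b : Tuple (Carrier B)) →
                     Generates A a → Similar A B a b → Embedding A B
  inducedEmbedding {A} {B} (_ , a) (_ , b) generates (eq , sim) = record
    { map       = λ x → ⟦ t x ⟧ B b′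
    ; congruent = λ {x} {y} x≈y → Equivalence.to (sim (t x ≐ t y))
        (A.≈-trans (value x) (A.≈-trans x≈y (A.≈-sym (value y))))
    ; injective = λ {x} {y} fx≈fy →
        A.≈-trans (A.≈-sym (value x))
          (A.≈-trans (Equivalence.from (sim (t x ≐ t y)) fx≈fy) (value y))
    ; map-rel   = λ R xs → mk⇔
        (λ r → Equivalence.to (sim (pred R (t ∘ xs)))
                 (A.rel-resp R (λ j → A.≈-sym (value (xs j))) r))
        (λ r → A.rel-resp R (λ j → value (xs j))
                 (Equivalence.from (sim (pred R (t ∘ xs))) r))
    ; map-fun   = λ F xs → Equivalence.to (sim (t (A.fun F xs) ≐ app F (t ∘ xs)))
        (A.≈-trans (value (A.fun F xs))
                   (A.fun-cong F (λ j → A.≈-sym (value (xs j)))))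
    }
    where
    module A = Structure A
    module B = Structure B
    b′ = b ∘ cast eq
    t : A.Carrier → Term L _
    t x = term A (generates x)
    value : ∀ x → ⟦ t x ⟧ A a A.≈ x
    value x = term-value A (generates x)

  inducedEmbedding-sends :
    ∀ {A B : Structure L} (a : Tuple (Carrier A)) (b : Tuple (Carrier B))
    (g : Generates A a) (s : Similar A B a b) (i : Fin (proj₁ a)) →
    Structure._≈_ B (Embedding.map (inducedEmbedding {A} {B} a b g s) (proj₂ a i))
                    (proj₂ b (cast (proj₁ s) i))
  inducedEmbedding-sends {A} (_ , a) (_ , b) g (eq , sim) i =
    Equivalence.to (sim (term A (g (a i)) ≐ var i)) (term-value A (g (a i)))

------------------------------------------------------------------------
-- Ages

module _ (L : Language) where

  record Age (ℓ : Level) : Set (lsuc 0ℓ ⊔ˡ lsuc ℓ) where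
    field
      𝒦                 : Pred (Structure L) ℓ
      isomorphismClosed : ∀ {A B} → A ≅ B → 𝒦 A → 𝒦 B
      finitelyGenerated : ∀ {A} → 𝒦 A → FinitelyGenerated A

module _ {L : Language} {ℓ : Level} where

  AmalgamationProperty : Age L ℓ → Set (lsuc 0ℓ ⊔ˡ ℓ)
  AmalgamationProperty K =
    ∀ {A B C : Structure L} → 𝒦 A → 𝒦 B → 𝒦 C →
    (fB : Embedding A B) (fC : Embedding A C) →
    Σ[ D ∈ Structure L ] (𝒦 D ×
      Σ[ αB ∈ Embedding B D ] Σ[ αC ∈ Embedding C D ]
        (αB ∘ᵉ fB) ≗ᵉ (αC ∘ᵉ fC))
    where open Age K

------------------------------------------------------------------------
-- Computable structures and computable ages

-- The subset M of ω, with its elements compared as numbers.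
subsetSetoid : Pred ℕ 0ℓ → Setoid 0ℓ 0ℓ
subsetSetoid M = On.setoid (≡.setoid ℕ) (proj₁ {B = M})

codeTuple : ∀ {M : Pred ℕ 0ℓ} → Tuple (∃ M) → ℕ
codeTuple (_ , a) = codeList (List.tabulate (proj₁ ∘ a))

-- A computable structure together with programs witnessing this. That the
-- universe is c.e. is implied by its being computable.
record ComputableStructure (L : Language) : Set₁ where
  field
    universe : Pred ℕ 0ℓ
    interp   : Interpretation L (subsetSetoid universe)
  open Interpretation interp using (rel; fun)
  field
    univ-program : Program 1
    univ-decides : Decides univ-program universe
    pos-program  : Program 1
    pos-ce       : Enumerates pos-program λ x →
                   Σ[ R ∈ RelSym L ] Σ[ a ∈ Vector (∃ universe) (relArity L R) ]
                   (x ≡ pair (proj₁ R) (codeTuple (_ , a)) × rel R a)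
    neg-program  : Program 1
    neg-ce       : Enumerates neg-program λ x →
                   Σ[ R ∈ RelSym L ] Σ[ a ∈ Vector (∃ universe) (relArity L R) ]
                   (x ≡ pair (proj₁ R) (codeTuple (_ , a)) × ¬ rel R a)
    fun-program  : Program 1
    fun-ce       : Enumerates fun-program λ x →
                   Σ[ F ∈ FunSym L ] Σ[ a ∈ Vector (∃ universe) (funArity L F) ]
                   Σ[ b ∈ ∃ universe ]
                   (x ≡ triple (proj₁ F) (codeTuple (_ , a)) (proj₁ b) ×
                    proj₁ (fun F a) ≡ proj₁ b)

  index : ℕ
  index = pair (pair ⌜ univ-program ⌝ ⌜ pos-program ⌝) (pair ⌜ neg-program ⌝ ⌜ fun-program ⌝)

  structure : Structure L
  structure = record { setoid = subsetSetoid universe ; interp = interp }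

-- The members (𝐚ᵢ , 𝒜ᵢ , i) of the representation are given as families
-- indexed by i; 𝕀 i is the number coding the triple.
record ComputableAge {L : Language} {ℓ : Level} (K : Age L ℓ) : Set (lsuc 0ℓ ⊔ˡ ℓ) where
  open Age K using (𝒦)
  field
    𝒜 : ℕ → ComputableStructure L

  𝒮 : ℕ → Structure L
  𝒮 i = ComputableStructure.structure (𝒜 i)

  field
    𝐚 : ∀ i → Tuple (Carrier (𝒮 i))

  𝕀 : ℕ → ℕ
  𝕀 i = triple (codeTuple (𝐚 i)) (ComputableStructure.index (𝒜 i)) i

  field
    ce        : CE (λ x → ∃[ i ] x ≡ 𝕀 i)
    member    : ∀ i → 𝒦 (𝒮 i)
    generates : ∀ i → Generates (𝒮 i) (𝐚 i)
    complete  : ∀ {B} → 𝒦 B → ∃[ i ] B ≅ 𝒮 i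

------------------------------------------------------------------------
-- Embedding information and amalgamation diagrams

module _ {L : Language} {ℓ : Level} {K : Age L ℓ} (𝕂 : ComputableAge K) where
  open ComputableAge 𝕂

  EmbeddingInformation : Pred ℕ 0ℓ
  EmbeddingInformation x =
    ∃[ k₀ ] Σ[ b₀ ∈ Tuple (Carrier (𝒮 k₀)) ]
    ∃[ k₁ ] Σ[ b₁ ∈ Tuple (Carrier (𝒮 k₁)) ]
      (x ≡ pair (𝕀 k₀) (triple (codeTuple b₀) (𝕀 k₁) (codeTuple b₁)) ×
       Similar (𝒮 k₀) (𝒮 k₁) b₀ b₁)

  -- The triple (𝕀 i , 𝕀 j , image). The length of the image is arbitrary.
  record PotentialEmbedding (i j : ℕ) : Set where
    constructor potentialEmbedding
    field image : Tuple (Carrier (𝒮 j))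

    code : ℕ
    code = triple (𝕀 i) (𝕀 j) (codeTuple image)

    IsEmbedding : Set
    IsEmbedding = Similar (𝒮 i) (𝒮 j) (𝐚 i) image

    encoded : IsEmbedding → Embedding (𝒮 i) (𝒮 j)
    encoded = inducedEmbedding (𝐚 i) image (generates i)

  open PotentialEmbedding using (IsEmbedding; encoded)

  record PotentialSpan : Set where
    field
      {i j₀ j₁} : ℕ
      F₀        : PotentialEmbedding i j₀
      F₁        : PotentialEmbedding i j₁

    code : ℕ
    code = pair (PotentialEmbedding.code F₀) (PotentialEmbedding.code F₁)

  record AmalgamationDiagram (S : PotentialSpan) : Set where
    open PotentialSpan S using (i; j₀; j₁; F₀; F₁)
    field
      {k}          : ℕ
      G₀           : PotentialEmbedding j₀ k
      G₁           : PotentialEmbedding j₁ k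
      G₀-embedding : IsEmbedding G₀
      amalgamates  :
        (f₀ : IsEmbedding F₀) (f₁ : IsEmbedding F₁) →
        Σ[ g₁ ∈ IsEmbedding G₁ ]
          ((encoded G₀ G₀-embedding ∘ᵉ encoded F₀ f₀) ≗ᵉ (encoded G₁ g₁ ∘ᵉ encoded F₁ f₁))

    code : ℕ
    code = pair (PotentialEmbedding.code G₀) (PotentialEmbedding.code G₁)

  -- One program, run with oracle X, sends (the code of) every potential span
  -- to (the code of) an amalgamation diagram over it. As usual, the oracle X
  -- is supplied through its characteristic function; without excluded middle
  -- this has to be quantified over, since it need not be definable from X.
  HasComputableAmalgamation : Pred ℕ 0ℓ → Set
  HasComputableAmalgamation X =
    Σ[ p ∈ Program 1 ] (∀ χ → IsCharacteristicFunction χ X →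
      ∀ (S : PotentialSpan) → Σ[ D ∈ AmalgamationDiagram S ]
        χ ⊢ p [ PotentialSpan.code S ∷ [] ]⇓ AmalgamationDiagram.code D)

module Submission where

-- Whether a potential span is a span is a question to the embedding
-- information. If it is, search for k, tuples d₀, d₁ (the images of the
-- generators b₀ of 𝒜ⱼ₀ and b₁ of 𝒜ⱼ₁) and a tuple e in 𝒜ₖ: with c₀, c₁ the
-- images of the generators a under F₀, F₁, the square commutes as soon as
-- b₀ c₀ ≃ d₀ e and b₁ c₁ ≃ d₁ e, so every condition is again a question to the
-- embedding information, and AP makes the search succeed. If it is not a span,
-- G₀ can be the identity and G₁ the potential embedding given by the empty tuple.

open import Defs

open import Level using (Level; 0ℓ)
open import Data.Bool.Base using (Bool; true; false; T; if_then_else_)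
open import Data.Bool.Properties using (T?)
open import Data.Nat.Base using (ℕ; zero; suc; _+_; _∸_; _≤_; _<_; z≤n; s≤s)
open import Data.Nat.Properties
  using (+-comm; +-suc; +-identityʳ; m+n∸m≡n; m+n∸n≡m; n∸n≡0; pred[m∸n]≡m∸[1+n];
         m≤n+m; ≤-trans; suc-injective)
open import Data.Fin.Base using (Fin; zero; suc; cast; _↑ˡ_; _↑ʳ_; splitAt)
open import Data.Fin.Patterns using (0F; 1F; 3F)
open import Data.Fin.Properties using (cast-is-id)
open import Data.Vec.Base as Vec using (Vec; []; _∷_)
open import Data.Vec.Properties using (lookup-map)
open import Data.Vec.Functional as Vector using (Vector)
open import Data.Vec.Functional.Properties using (lookup-++ˡ; lookup-++ʳ)
open import Data.List.Base as List using (List; []; _∷_; _++_; _ʳ++_; length)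
open import Data.List.Properties using (tabulate-cong; ∷-injective; ʳ++-ʳ++)
open import Data.List.Relation.Binary.Pointwise.Base using (Pointwise; []; _∷_)
open import Data.List.Relation.Unary.All as All using (All; []; _∷_; all?)
open import Data.Product.Base using (∃; ∃-syntax; Σ-syntax; _×_; _,_; proj₁; proj₂)
open import Data.Sum.Base using (inj₁; inj₂)
open import Function.Base using (_∘_)
open import Function.Bundles using (_⇔_; mk⇔; Equivalence)
open import Relation.Nullary using (¬_; Dec; yes; no; contradiction)
open import Relation.Unary using (Pred)
open import Relation.Binary.PropositionalEquality
  using (_≡_; refl; sym; trans; cong; cong₂; subst; subst₂; module ≡-Reasoning)

-- Total programs

-- A program is bundled with the function it computes, which may depend on the oracle, so that
-- compound programs come with their halting proofs and most correctness proofs reduce to `refl`.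
record Total (n : ℕ) : Set where
  field
    program : Program n
    value   : (ℕ → Bool) → Vec ℕ n → ℕ
    halts   : ∀ χ xs → χ ⊢ program [ xs ]⇓ value χ xs

open Total

private
  variable
    m n : ℕ

compose : Total m → Vec (Total n) m → Total n
compose f gs .program    = comp (program f) (Vec.map program gs)
compose f gs .value χ xs = value f χ (Vec.map (λ g → value g χ xs) gs)
compose f gs .halts χ xs = ⇓comp _
  (λ i → subst₂ (λ p y → χ ⊢ p [ xs ]⇓ y)
           (sym (lookup-map i program gs)) (sym (lookup-map i (λ g → value g χ xs) gs))
           (halts (Vec.lookup gs i) χ xs))
  (halts f χ _)

-- Keeps the program but presents its value by a readable formula, so that larger constructions do
-- not accumulate the values of nested recursions.
withValue : (p : Total n) (f : (ℕ → Bool) → Vec ℕ n → ℕ) →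
            (∀ χ xs → value p χ xs ≡ f χ xs) → Total n
withValue p f eq .program    = program p
withValue p f eq .value      = f
withValue p f eq .halts χ xs = subst (χ ⊢ program p [ xs ]⇓_) (eq χ xs) (halts p χ xs)

-- The intended function `h` is given in advance, so only its two recursion equations have to be
-- checked, the second one at the correct previous value `h k xs`.
primitiveRecursion :
  (f : Total n) (g : Total (2 + n)) (h : ℕ → Vec ℕ n → ℕ) →
  (∀ χ xs → value f χ xs ≡ h 0 xs) →
  (∀ χ k xs → value g χ (k ∷ h k xs ∷ xs) ≡ h (suc k) xs) →
  Total (suc n)
primitiveRecursion f g h base step = record
  { program = prec (program f) (program g)
  ; value   = λ χ xs → h (Vec.head xs) (Vec.tail xs)
  ; halts   = λ { χ (k ∷ xs) → run χ k xs }
  }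
  where
  run : ∀ χ k xs → χ ⊢ prec (program f) (program g) [ k ∷ xs ]⇓ h k xs
  run χ zero    xs = ⇓prec-0 (subst (χ ⊢ program f [ xs ]⇓_) (base χ xs) (halts f χ xs))
  run χ (suc k) xs = ⇓prec-s (run χ k xs)
    (subst (χ ⊢ program g [ _ ]⇓_) (step χ k xs) (halts g χ _))

projᵀ : Fin n → Total n
projᵀ i .program    = proj i
projᵀ i .value χ xs = Vec.lookup xs i
projᵀ i .halts χ xs = ⇓proj i

zeroᵀ : Total n
zeroᵀ .program    = zeroᵖ
zeroᵀ .value χ xs = 0
zeroᵀ .halts χ xs = ⇓zero

sucᵀ : Total n → Total n
sucᵀ p = compose successor (p ∷ [])
  where
  successor : Total 1
  successor .program          = sucᵖ
  successor .value χ xs       = suc (Vec.head xs)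
  successor .halts χ (x ∷ []) = ⇓suc

oracleᵀ : Total n → Total n
oracleᵀ p = compose query (p ∷ [])
  where
  query : Total 1
  query .program          = oracle
  query .value χ xs       = if χ (Vec.head xs) then 1 else 0
  query .halts χ (x ∷ []) = ⇓oracle

ifZero : ℕ → ℕ → ℕ → ℕ
ifZero zero    x y = x
ifZero (suc _) x y = y

ifZeroᵀ : Total n → Total n → Total n → Total n
ifZeroᵀ p q r = compose
  -- The step receives the counter, the previous value and then the two branches, so index 3 is the
  -- second branch.
  (primitiveRecursion (projᵀ 0F) (projᵀ 3F)
    (λ k xs → ifZero k (Vec.lookup xs 0F) (Vec.lookup xs 1F))
    (λ _ _ → refl) (λ _ _ _ → refl))
  (p ∷ q ∷ r ∷ [])

_+ᵀ_ : Total n → Total n → Total n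
p +ᵀ q = withValue
  (compose
    (primitiveRecursion (projᵀ 0F) (sucᵀ (projᵀ 1F)) (λ k xs → k + Vec.lookup xs 0F)
      (λ _ _ → refl) (λ _ _ _ → refl))
    (p ∷ q ∷ []))
  (λ χ xs → value p χ xs + value q χ xs) (λ _ _ → refl)

predᵀ : Total n → Total n
predᵀ p = withValue
  (compose
    (primitiveRecursion zeroᵀ (projᵀ 0F) (λ k _ → k ∸ 1) (λ _ _ → refl) (λ _ _ _ → refl))
    (p ∷ []))
  (λ χ xs → value p χ xs ∸ 1) (λ _ _ → refl)

_∸ᵀ_ : Total n → Total n → Total n
p ∸ᵀ q = withValue
  (compose
    (primitiveRecursion (projᵀ 0F) (predᵀ (projᵀ 1F)) (λ k xs → Vec.lookup xs 0F ∸ k)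
      (λ _ _ → refl) (λ _ k xs → pred[m∸n]≡m∸[1+n] (Vec.lookup xs 0F) k))
    -- The recursion runs on the subtrahend, which therefore comes first.
    (q ∷ p ∷ []))
  (λ χ xs → value p χ xs ∸ value q χ xs) (λ _ _ → refl)

triangleᵀ : Total n → Total n
triangleᵀ p = withValue
  (compose
    (primitiveRecursion zeroᵀ (sucᵀ (projᵀ 0F) +ᵀ projᵀ 1F) (λ k _ → triangle k)
      (λ _ _ → refl) (λ _ _ _ → refl))
    (p ∷ []))
  (λ χ xs → triangle (value p χ xs)) (λ _ _ → refl)

-- The Cantor pairing and its inverse

-- Unification must not unfold these operations into records of programs, hence
-- the opaque blocks.
opaque
  pairᵀ : Total n → Total n → Total n
  pairᵀ p q = withValue (triangleᵀ (p +ᵀ q) +ᵀ q)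
    (λ χ xs → pair (value p χ xs) (value q χ xs)) (λ _ _ → refl)

-- diagonal (pair x y) is x + y; it grows when n ↦ suc n passes from a code of
-- (0 , y) to a code of (suc y , 0).
diagonal : ℕ → ℕ
diagonal zero    = 0
diagonal (suc n) = ifZero (diagonal n ∸ (n ∸ triangle (diagonal n))) (suc (diagonal n)) (diagonal n)

π₁ π₂ : ℕ → ℕ
π₂ n = n ∸ triangle (diagonal n)
π₁ n = diagonal n ∸ π₂ n

diagonalᵀ : Total n → Total n
diagonalᵀ p = withValue
  (compose
    (primitiveRecursion zeroᵀ
      (ifZeroᵀ (projᵀ 1F ∸ᵀ (projᵀ 0F ∸ᵀ triangleᵀ (projᵀ 1F))) (sucᵀ (projᵀ 1F)) (projᵀ 1F))
      (λ k _ → diagonal k)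
      (λ _ _ → refl) (λ _ _ _ → refl))
    (p ∷ []))
  (λ χ xs → diagonal (value p χ xs)) (λ _ _ → refl)

opaque
  π₁ᵀ π₂ᵀ : Total n → Total n
  π₂ᵀ p = withValue (p ∸ᵀ triangleᵀ (diagonalᵀ p))
    (λ χ xs → π₂ (value p χ xs)) (λ _ _ → refl)
  π₁ᵀ p = withValue (diagonalᵀ p ∸ᵀ π₂ᵀ p)
    (λ χ xs → π₁ (value p χ xs)) (λ _ _ → refl)

diagonal-suc : ∀ s y → diagonal (triangle s + y) ≡ s →
               diagonal (suc (triangle s + y)) ≡ ifZero (s ∸ y) (suc s) s
diagonal-suc s y eq rewrite eq | m+n∸m≡n (triangle s) y = refl

-- The argument `x` witnesses that `y` does not exceed `s`. The induction walks back along the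
-- codes: down in `y` on one diagonal, and from its first code to the last code `(0 , s)` of the
-- previous diagonal.
diagonal-triangle : ∀ s y x → s ≡ x + y → diagonal (triangle s + y) ≡ s
diagonal-triangle zero zero x eq = refl
diagonal-triangle zero (suc y) x eq = contradiction (trans eq (+-suc x y)) λ ()
diagonal-triangle (suc s) zero x eq = begin
  diagonal (triangle (suc s) + 0)    ≡⟨ cong diagonal (+-identityʳ (triangle (suc s))) ⟩
  diagonal (suc (s + triangle s))    ≡⟨ cong (diagonal ∘ suc) (+-comm s (triangle s)) ⟩
  diagonal (suc (triangle s + s))    ≡⟨ diagonal-suc s s (diagonal-triangle s s 0 refl) ⟩
  ifZero (s ∸ s) (suc s) s           ≡⟨ cong (λ d → ifZero d (suc s) s) (n∸n≡0 s) ⟩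
  suc s                              ∎
  where open ≡-Reasoning
diagonal-triangle s@(suc _) (suc y) x eq = begin
  diagonal (triangle s + suc y)      ≡⟨ cong diagonal (+-suc (triangle s) y) ⟩
  diagonal (suc (triangle s + y))    ≡⟨ diagonal-suc s y (diagonal-triangle s y (suc x) s≡) ⟩
  ifZero (s ∸ y) (suc s) s           ≡⟨ cong (λ d → ifZero d (suc s) s) s∸y≡ ⟩
  s                                  ∎
  where
  open ≡-Reasoning
  s≡ : s ≡ suc x + y
  s≡ = trans eq (+-suc x y)
  s∸y≡ : s ∸ y ≡ suc x
  s∸y≡ = trans (cong (_∸ y) s≡) (m+n∸n≡m (suc x) y)

diagonal-pair : ∀ x y → diagonal (pair x y) ≡ x + y
diagonal-pair x y = diagonal-triangle (x + y) y x refl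

π₂-pair : ∀ x y → π₂ (pair x y) ≡ y
π₂-pair x y = trans (cong (λ d → pair x y ∸ triangle d) (diagonal-pair x y))
                    (m+n∸m≡n (triangle (x + y)) y)

π₁-pair : ∀ x y → π₁ (pair x y) ≡ x
π₁-pair x y = trans (cong₂ _∸_ (diagonal-pair x y) (π₂-pair x y)) (m+n∸n≡m x y)

pair-injective : ∀ x y x′ y′ → pair x y ≡ pair x′ y′ → x ≡ x′ × y ≡ y′
pair-injective x y x′ y′ eq =
  trans (sym (π₁-pair x y)) (trans (cong π₁ eq) (π₁-pair x′ y′)) ,
  trans (sym (π₂-pair x y)) (trans (cong π₂ eq) (π₂-pair x′ y′))

codeList-injective : ∀ {xs ys} → codeList xs ≡ codeList ys → xs ≡ ys
codeList-injective {[]}     {[]}     eq = refl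
codeList-injective {x ∷ xs} {y ∷ ys} eq
  with x≡y , xs≡ys ← pair-injective x (codeList xs) y (codeList ys) (suc-injective eq) =
  cong₂ _∷_ x≡y (codeList-injective xs≡ys)

-- Concatenation of coded lists

-- One round moves the head of the first of a pair of coded lists onto the second.
shift : ℕ → ℕ
shift s = ifZero (π₁ s) s (pair (π₂ (π₁ s ∸ 1)) (suc (pair (π₁ (π₁ s ∸ 1)) (π₂ s))))

shifts : ℕ → ℕ → ℕ
shifts zero    s = s
shifts (suc k) s = shift (shifts k s)

-- A coded list has at most as many entries as its code, so that many rounds
-- suffice.
reverseAppend : ℕ → ℕ → ℕ
reverseAppend x y = π₂ (shifts x (pair x y))

-- The first list is reversed twice, so its order is restored.
append : ℕ → ℕ → ℕ
append x y = reverseAppend (reverseAppend x 0) y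

opaque
  unfolding pairᵀ π₁ᵀ π₂ᵀ

  shiftᵀ : Total n → Total n
  shiftᵀ p = withValue (ifZeroᵀ (π₁ᵀ p) p
    (pairᵀ (π₂ᵀ (predᵀ (π₁ᵀ p))) (sucᵀ (pairᵀ (π₁ᵀ (predᵀ (π₁ᵀ p))) (π₂ᵀ p)))))
    (λ χ xs → shift (value p χ xs)) (λ _ _ → refl)

  shiftsᵀ : Total n → Total n → Total n
  shiftsᵀ p q = withValue
    (compose
      (primitiveRecursion (projᵀ 0F) (shiftᵀ (projᵀ 1F)) (λ k xs → shifts k (Vec.lookup xs 0F))
        (λ _ _ → refl) (λ _ _ _ → refl))
      (p ∷ q ∷ []))
    (λ χ xs → shifts (value p χ xs) (value q χ xs)) (λ _ _ → refl)

  reverseAppendᵀ : Total n → Total n → Total n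
  reverseAppendᵀ p q = withValue (π₂ᵀ (shiftsᵀ p (pairᵀ p q)))
    (λ χ xs → reverseAppend (value p χ xs) (value q χ xs)) (λ _ _ → refl)

  appendᵀ : Total n → Total n → Total n
  appendᵀ p q = withValue (reverseAppendᵀ (reverseAppendᵀ p zeroᵀ) q)
    (λ χ xs → append (value p χ xs) (value q χ xs)) (λ _ _ → refl)

shift-[] : ∀ y → shift (pair 0 y) ≡ pair 0 y
shift-[] y rewrite π₁-pair 0 y = refl

shift-∷ : ∀ x r y → shift (pair (suc (pair x r)) y) ≡ pair r (suc (pair x y))
shift-∷ x r y
  rewrite π₁-pair (suc (pair x r)) y | π₂-pair (suc (pair x r)) y | π₁-pair x r | π₂-pair x r = refl

-- `shifts` puts the last round outermost, whereas induction on the list needs the first round split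
-- off.
shifts-suc : ∀ k s → shifts (suc k) s ≡ shifts k (shift s)
shifts-suc zero    s = refl
shifts-suc (suc k) s = cong shift (shifts-suc k s)

shifts-codeList : ∀ k xs ys → length xs ≤ k →
                  shifts k (pair (codeList xs) (codeList ys)) ≡ pair 0 (codeList (xs ʳ++ ys))
shifts-codeList zero    []       ys _ = refl
shifts-codeList (suc k) []       ys _ =
  trans (cong shift (shifts-codeList k [] ys z≤n)) (shift-[] (codeList ys))
shifts-codeList (suc k) (x ∷ xs) ys (s≤s le) =
  trans (shifts-suc k _)
    (trans (cong (shifts k) (shift-∷ x (codeList xs) (codeList ys)))
           (shifts-codeList k xs (x ∷ ys) le))

length≤codeList : ∀ xs → length xs ≤ codeList xs
length≤codeList []       = z≤n
length≤codeList (x ∷ xs) = s≤s (≤-trans (length≤codeList xs) (m≤n+m (codeList xs) _))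

reverseAppend-codeList : ∀ xs ys → reverseAppend (codeList xs) (codeList ys) ≡ codeList (xs ʳ++ ys)
reverseAppend-codeList xs ys =
  trans (cong π₂ (shifts-codeList (codeList xs) xs ys (length≤codeList xs))) (π₂-pair 0 _)

append-codeList : ∀ xs ys → append (codeList xs) (codeList ys) ≡ codeList (xs ++ ys)
append-codeList xs ys =
  trans (cong (λ r → reverseAppend r (codeList ys)) (reverseAppend-codeList xs []))
    (trans (reverseAppend-codeList (xs ʳ++ []) ys) (cong codeList (ʳ++-ʳ++ xs)))

-- Least zeros and oracle tests

leastZero : ∀ (f : ℕ → ℕ) m → f m ≡ 0 → ∃[ y ] (f y ≡ 0 × ∀ z → z < y → ∃[ w ] f z ≡ suc w)
leastZero f zero    eq = 0 , eq , λ _ ()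
-- Shifting `f` brings the known zero one step closer; the positive values passed on the way are
-- what `⇓mu` asks for.
leastZero f (suc m) eq with f 0 in f0
... | zero  = 0 , f0 , λ _ ()
... | suc w with y , fy≡0 , least ← leastZero (f ∘ suc) m eq =
  suc y , fy≡0 , λ { zero _ → w , f0 ; (suc z) (s≤s z<y) → least z z<y }

-- A conjunction of oracle queries, with `p` for success and `r` for failure. A rejected query is
-- answered by 0, so `r` stands in the zero branch.
accepting : List (Total n) → Total n → Total n → Total n
accepting []       p r = p
accepting (q ∷ qs) p r = ifZeroᵀ (oracleᵀ q) r (accepting qs p r)

-- Atomic types and embeddings

_⊕_ : ∀ {A : Set} → Tuple A → Tuple A → Tuple A
(m , a) ⊕ (n , b) = m + n , (a Vector.++ b)

image : ∀ {A B : Set} → (A → B) → Tuple A → Tuple B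
image f (n , a) = n , f ∘ a

module _ {L : Language} where

  open Embedding using (map; congruent; injective; map-rel; map-fun)

  module _ (A : Structure L) where
    open Structure A

    ⟦⟧-cong : ∀ (t : Term L n) {a b : Vector Carrier n} → (∀ i → a i ≈ b i) → ⟦ t ⟧ A a ≈ ⟦ t ⟧ A b
    ⟦⟧-cong (var i)    a≈b = a≈b i
    ⟦⟧-cong (app F ts) a≈b = fun-cong F λ j → ⟦⟧-cong (ts j) a≈b

    ⊨-resp : ∀ (φ : Atomic L n) {a b : Vector Carrier n} → (∀ i → a i ≈ b i) →
             A ⊨ φ [ a ] → A ⊨ φ [ b ]
    ⊨-resp (pred R ts) a≈b = rel-resp R λ j → ⟦⟧-cong (ts j) a≈b
    ⊨-resp (s ≐ t)     a≈b eq =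
      ≈-trans (≈-sym (⟦⟧-cong s a≈b)) (≈-trans eq (⟦⟧-cong t a≈b))

    _≋_ : Tuple Carrier → Tuple Carrier → Set
    (m , a) ≋ (n , b) = Σ[ eq ∈ m ≡ n ] ∀ i → a i ≈ b (cast eq i)

    ≡⇒≈ : ∀ {x y} → x ≡ y → x ≈ y
    ≡⇒≈ refl = ≈-refl

    similar-refl : ∀ a → Similar A A a a
    similar-refl (_ , a) = refl , λ φ → mk⇔
      -- `cast refl i` does not reduce to `i` for a variable `i`, hence the detour through
      -- `cast-is-id`.
      (⊨-resp φ λ i → ≡⇒≈ (cong a (sym (cast-is-id refl i))))
      (⊨-resp φ λ i → ≡⇒≈ (cong a (cast-is-id refl i)))

    -- Ensures that a generating tuple stays generating when extended, so that the extended tuple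
    -- induces an embedding too.
    cl-++ˡ : ∀ (a : Vector Carrier m) (c : Vector Carrier n) {x} →
             cl A a x → cl A (a Vector.++ c) x
    cl-++ˡ {n = n} a c (gen i)  = resp (≡⇒≈ (lookup-++ˡ a c i)) (gen (i ↑ˡ n))
    cl-++ˡ a c (app F ps)  = app F λ j → cl-++ˡ a c (ps j)
    cl-++ˡ a c (resp eq p) = resp eq (cl-++ˡ a c p)

  module _ {A B : Structure L} where
    private
      module A = Structure A
      module B = Structure B

    -- Needed because codes determine tuples only up to `≋`: they forget the proofs that the entries
    -- lie in the universe.
    similar-resp : ∀ a a′ b b′ → _≋_ A a a′ → _≋_ B b b′ → Similar A B a b → Similar A B a′ b′
    similar-resp (_ , a) (_ , a′) (_ , b) (_ , b′) (refl , a≈) (refl , b≈) (refl , sim) =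
      refl , λ φ → mk⇔
      (λ h → ⊨-resp B φ b≈b′ (Equivalence.to (sim φ) (⊨-resp A φ (λ i → A.≈-sym (a≈a′ i)) h)))
      (λ h → ⊨-resp A φ a≈a′ (Equivalence.from (sim φ) (⊨-resp B φ (λ i → B.≈-sym (b≈b′ i)) h)))
      where
      a≈a′ : ∀ i → a i A.≈ a′ i
      a≈a′ i = A.≈-trans (a≈ i) (≡⇒≈ A (cong a′ (cast-is-id refl i)))
      b≈b′ : ∀ i → b (cast refl i) B.≈ b′ (cast refl i)
      b≈b′ i = B.≈-trans (≡⇒≈ B (cong b (cast-is-id refl i))) (b≈ i)

    module _ (f : Embedding A B) where

      map-⟦⟧ : ∀ (t : Term L n) {a : Vector A.Carrier n} → map f (⟦ t ⟧ A a) B.≈ ⟦ t ⟧ B (map f ∘ a)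
      map-⟦⟧ (var i)    = B.≈-refl
      map-⟦⟧ (app F ts) = B.≈-trans (map-fun f F _) (B.fun-cong F λ j → map-⟦⟧ (ts j))

      -- Terms commute with the map; relations are then reflected by `map-rel` and equations by
      -- injectivity.
      map-⊨ : ∀ (φ : Atomic L n) {a : Vector A.Carrier n} → (A ⊨ φ [ a ]) ⇔ (B ⊨ φ [ map f ∘ a ])
      map-⊨ (pred R ts) = mk⇔
        (λ h → B.rel-resp R (λ j → map-⟦⟧ (ts j)) (Equivalence.to (map-rel f R _) h))
        (λ h → Equivalence.from (map-rel f R _) (B.rel-resp R (λ j → B.≈-sym (map-⟦⟧ (ts j))) h))
      map-⊨ (s ≐ t) = mk⇔
        (λ h → B.≈-trans (B.≈-sym (map-⟦⟧ s)) (B.≈-trans (congruent f h) (map-⟦⟧ t)))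
        (λ h → injective f (B.≈-trans (map-⟦⟧ s) (B.≈-trans h (B.≈-sym (map-⟦⟧ t)))))

      -- Allowing `b` to be the image only up to `≈` lets one tuple serve as the image of `c₀` and
      -- of `c₁` along the two legs of an amalgam.
      similar-image : ∀ (a : Vector A.Carrier n) (b : Vector B.Carrier n) →
                      (∀ i → map f (a i) B.≈ b i) → Similar A B (n , a) (n , b)
      similar-image a b fa≈b = refl , λ φ → mk⇔
        (λ h → ⊨-resp B φ fa≈b′ (Equivalence.to (map-⊨ φ) h))
        (λ h → Equivalence.from (map-⊨ φ) (⊨-resp B φ (λ i → B.≈-sym (fa≈b′ i)) h))
        where
        fa≈b′ : ∀ i → map f (a i) B.≈ b (cast refl i)
        fa≈b′ i = B.≈-trans (fa≈b i) (≡⇒≈ B (cong b (sym (cast-is-id refl i))))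

      similar-image-⊕ : ∀ (a : Vector A.Carrier m) (c : Vector A.Carrier n) b d →
                        (∀ i → map f (a i) B.≈ b i) → (∀ i → map f (c i) B.≈ d i) →
                        Similar A B ((m , a) ⊕ (n , c)) ((m , b) ⊕ (n , d))
      similar-image-⊕ {m} a c b d fa≈b fc≈d = similar-image (a Vector.++ c) (b Vector.++ d) pointwise
        where
        pointwise : ∀ i → map f ((a Vector.++ c) i) B.≈ (b Vector.++ d) i
        pointwise i with splitAt m i
        ... | inj₁ j = fa≈b j
        ... | inj₂ j = fc≈d j

    -- The set on which two embeddings agree is closed under the functions and under `≈`, so
    -- agreement spreads from generators to their closure.
    embeddings-agree : ∀ (f g : Embedding A B) {a : Vector A.Carrier n} →
                       (∀ i → map f (a i) B.≈ map g (a i)) → ∀ {x} → cl A a x → map f x B.≈ map g x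
    embeddings-agree f g agree (gen i)     = agree i
    embeddings-agree f g agree (app F ps)  =
      B.≈-trans (map-fun f F _)
        (B.≈-trans (B.fun-cong F λ j → embeddings-agree f g agree (ps j)) (B.≈-sym (map-fun g F _)))
    embeddings-agree f g agree (resp eq p) =
      B.≈-trans (congruent f (A.≈-sym eq)) (B.≈-trans (embeddings-agree f g agree p) (congruent g eq))

    sends : ∀ (a : Vector A.Carrier n) (b : Vector B.Carrier n) (g : Generates A (n , a))
            (s : Similar A B (n , a) (n , b)) i →
            map (inducedEmbedding (n , a) (n , b) g s) (a i) B.≈ b i
    sends {n} a b g s i =
      B.≈-trans (inducedEmbedding-sends (n , a) (n , b) g s i)
                (≡⇒≈ B (cong b (cast-is-id (proj₁ s) i)))

    -- The embeddings induced by a ≃ b and by a ⊕ c ≃ b ⊕ d agree on the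
    -- generators a.
    sends-extension :
      ∀ (a : Vector A.Carrier m) (c : Vector A.Carrier n) b d
      (g : Generates A (m , a)) (s : Similar A B (m , a) (m , b)) →
      Similar A B ((m , a) ⊕ (n , c)) ((m , b) ⊕ (n , d)) →
      ∀ i → map (inducedEmbedding (m , a) (m , b) g s) (c i) B.≈ d i
    sends-extension {m} {n} a c b d g s s⁺ i = begin
      map f (c i)              ≈⟨ embeddings-agree f f⁺ agree (g (c i)) ⟩
      map f⁺ (c i)             ≡⟨ cong (map f⁺) (lookup-++ʳ a c i) ⟨
      map f⁺ (ac (m ↑ʳ i))     ≈⟨ sends ac bd g⁺ s⁺ (m ↑ʳ i) ⟩
      bd (m ↑ʳ i)              ≡⟨ lookup-++ʳ b d i ⟩
      d i                      ∎
      where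
      open import Relation.Binary.Reasoning.Setoid B.setoid
      ac = a Vector.++ c
      bd = b Vector.++ d
      g⁺ : Generates A (m + n , ac)
      g⁺ x = cl-++ˡ A a c (g x)
      f  = inducedEmbedding (m , a) (m , b) g s
      f⁺ = inducedEmbedding (m + n , ac) (m + n , bd) g⁺ s⁺
      agree : ∀ i → map f (a i) B.≈ map f⁺ (a i)
      agree i = begin
        map f (a i)              ≈⟨ sends a b g s i ⟩
        b i                      ≡⟨ lookup-++ˡ b d i ⟨
        bd (i ↑ˡ n)              ≈⟨ sends ac bd g⁺ s⁺ (i ↑ˡ n) ⟨
        map f⁺ (ac (i ↑ˡ n))     ≡⟨ cong (map f⁺) (lookup-++ˡ a c i) ⟩
        map f⁺ (a i)             ∎

  module _ {A B₀ B₁ D : Structure L}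
           (a  : Tuple (Structure.Carrier A))  (g  : Generates A a)
           (b₀ : Tuple (Structure.Carrier B₀)) (g₀ : Generates B₀ b₀)
           (b₁ : Tuple (Structure.Carrier B₁)) (g₁ : Generates B₁ b₁) where

    -- Both composites send the generators `a` to `e`: `sends` takes `a` to `c₀` or `c₁`, and
    -- `sends-extension` takes these on to `e`.
    commutes : ∀ c₀ c₁ d₀ d₁ e →
      (f₀ : Similar A B₀ a c₀) (f₁ : Similar A B₁ a c₁)
      (h₀ : Similar B₀ D b₀ d₀) (h₁ : Similar B₁ D b₁ d₁) →
      Similar B₀ D c₀ e →
      Similar B₀ D (b₀ ⊕ c₀) (d₀ ⊕ e) → Similar B₁ D (b₁ ⊕ c₁) (d₁ ⊕ e) →
      (inducedEmbedding b₀ d₀ g₀ h₀ ∘ᵉ inducedEmbedding a c₀ g f₀) ≗ᵉ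
      (inducedEmbedding b₁ d₁ g₁ h₁ ∘ᵉ inducedEmbedding a c₁ g f₁)
    commutes (_ , c₀) (_ , c₁) (_ , d₀) (_ , d₁) (_ , e)
      -- Matching on the length equations ensures that the concatenations on the two sides of `s₀`
      -- and `s₁` are split at the same place; `c₀ ≃ e` fixes the length of `e`.
      f₀@(refl , _) f₁@(refl , _) h₀@(refl , _) h₁@(refl , _) (refl , _) s₀ s₁ x =
      embeddings-agree (H₀ ∘ᵉ F₀) (H₁ ∘ᵉ F₁) (λ i → D.≈-trans (via₀ i) (D.≈-sym (via₁ i))) (g x)
      where
      module D = Structure D
      F₀ = inducedEmbedding a (_ , c₀) g f₀
      F₁ = inducedEmbedding a (_ , c₁) g f₁
      H₀ = inducedEmbedding b₀ (_ , d₀) g₀ h₀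
      H₁ = inducedEmbedding b₁ (_ , d₁) g₁ h₁
      via₀ : ∀ i → map H₀ (map F₀ (proj₂ a i)) D.≈ e i
      via₀ i = D.≈-trans (congruent H₀ (sends (proj₂ a) c₀ g f₀ i))
                         (sends-extension (proj₂ b₀) c₀ d₀ e g₀ h₀ s₀ i)
      via₁ : ∀ i → map H₁ (map F₁ (proj₂ a i)) D.≈ e i
      via₁ i = D.≈-trans (congruent H₁ (sends (proj₂ a) c₁ g f₁ i))
                         (sends-extension (proj₂ b₁) c₁ d₁ e g₁ h₁ s₁ i)

    -- Here e is the common image of the generators a.
    amalgam-similar : ∀ c₀ c₁ (f₀ : Similar A B₀ a c₀) (f₁ : Similar A B₁ a c₁)
      (α₀ : Embedding B₀ D) (α₁ : Embedding B₁ D) →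
      (α₀ ∘ᵉ inducedEmbedding a c₀ g f₀) ≗ᵉ (α₁ ∘ᵉ inducedEmbedding a c₁ g f₁) →
      let d₀ = image (map α₀) b₀ ; d₁ = image (map α₁) b₁ ; e = image (map α₀) c₀ in
      Similar B₀ D b₀ d₀ × Similar B₁ D b₁ d₁ × Similar B₀ D c₀ e ×
      Similar B₀ D (b₀ ⊕ c₀) (d₀ ⊕ e) × Similar B₁ D (b₁ ⊕ c₁) (d₁ ⊕ e)
    amalgam-similar (_ , c₀) (_ , c₁) f₀@(refl , _) f₁@(refl , _) α₀ α₁ square =
      similar-image α₀ (proj₂ b₀) _ (λ _ → D.≈-refl) ,
      similar-image α₁ (proj₂ b₁) _ (λ _ → D.≈-refl) ,
      similar-image α₀ c₀ _ (λ _ → D.≈-refl) ,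
      similar-image-⊕ α₀ (proj₂ b₀) c₀ _ _ (λ _ → D.≈-refl) (λ _ → D.≈-refl) ,
      similar-image-⊕ α₁ (proj₂ b₁) c₁ _ _ (λ _ → D.≈-refl) same
      where
      module D = Structure D
      -- `c₁ i` and `c₀ i` are both images of the same generator from `a`, so the commuting square
      -- at that generator connects them.
      same : ∀ i → map α₁ (c₁ i) D.≈ map α₀ (c₀ i)
      same i =
        D.≈-trans (congruent α₁ (Structure.≈-sym B₁ (sends (proj₂ a) c₁ g f₁ i)))
          (D.≈-trans (D.≈-sym (square (proj₂ a i))) (congruent α₀ (sends (proj₂ a) c₀ g f₀ i)))

-- Coded tuples

tabulate-injective : ∀ {A : Set} (f : Fin m → A) (g : Fin n → A) →
                     List.tabulate f ≡ List.tabulate g →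
                     Σ[ eq ∈ m ≡ n ] ∀ i → f i ≡ g (cast eq i)
tabulate-injective {zero}  {zero}  f g eq = refl , λ ()
tabulate-injective {suc m} {suc n} f g eq
  with head , tail ← ∷-injective eq
  with refl , pointwise ← tabulate-injective (f ∘ suc) (g ∘ suc) tail =
  refl , λ { zero → head ; (suc i) → pointwise i }

tabulate-++ : ∀ {A B : Set} (h : A → B) (a : Vector A m) (c : Vector A n) →
              List.tabulate (h ∘ (a Vector.++ c)) ≡ List.tabulate (h ∘ a) ++ List.tabulate (h ∘ c)
tabulate-++ {zero}  h a c = refl
tabulate-++ {suc m} h a c =
  cong (h (a zero) ∷_) (trans (tabulate-cong λ i → cong h (shifted i)) (tabulate-++ h (a ∘ suc) c))
  where
  shifted : ∀ i → (a Vector.++ c) (suc i) ≡ ((a ∘ suc) Vector.++ c) i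
  shifted i with splitAt m i
  ... | inj₁ _ = refl
  ... | inj₂ _ = refl

module _ {M : Pred ℕ 0ℓ} where

  codeTuple-injective : ∀ (a b : Tuple (∃ M)) → codeTuple a ≡ codeTuple b →
                        Σ[ eq ∈ proj₁ a ≡ proj₁ b ] ∀ i → proj₁ (proj₂ a i) ≡ proj₁ (proj₂ b (cast eq i))
  codeTuple-injective (_ , a) (_ , b) eq =
    tabulate-injective (proj₁ ∘ a) (proj₁ ∘ b) (codeList-injective eq)

  codeTuple-⊕ : ∀ (a b : Tuple (∃ M)) → append (codeTuple a) (codeTuple b) ≡ codeTuple (a ⊕ b)
  codeTuple-⊕ (_ , a) (_ , b) =
    trans (append-codeList (List.tabulate (proj₁ ∘ a)) _) (cong codeList (sym (tabulate-++ proj₁ a b)))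

-- The amalgamation program

-- The shape of the elements of `EmbeddingInformation`, but with arbitrary numbers, as the search
-- cannot tell beforehand which of them are codes.
query : ℕ → ℕ → ℕ → ℕ → ℕ
query I b J c = pair I (triple b J c)

tripleᵀ : Total n → Total n → Total n → Total n
tripleᵀ p q r = pairᵀ p (pairᵀ q r)

queryᵀ : Total n → Total n → Total n → Total n → Total n
queryᵀ I b J c = pairᵀ I (tripleᵀ b J c)

spanQueries : (I a J₀ c₀ J₁ c₁ : ℕ) → List ℕ
spanQueries I a J₀ c₀ J₁ c₁ = query I a J₀ c₀ ∷ query I a J₁ c₁ ∷ []

-- W = 𝕀 k, and G₀, G₁ send the generators to d₀, d₁. The last two queries say
-- that G₀ sends c₀ to e and G₁ sends c₁ to e; the third one makes e a tuple of
-- 𝒜ₖ of the same length as c₀.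
diagramQueries : (J₀ b₀ c₀ J₁ b₁ c₁ W d₀ d₁ e : ℕ) → List ℕ
diagramQueries J₀ b₀ c₀ J₁ b₁ c₁ W d₀ d₁ e =
  query J₀ b₀ W d₀ ∷ query J₁ b₁ W d₁ ∷ query J₀ c₀ W e ∷
  query J₀ (append b₀ c₀) W (append d₀ e) ∷ query J₁ (append b₁ c₁) W (append d₁ e) ∷ []

diagramCode : (J₀ d₀ J₁ d₁ W : ℕ) → ℕ
diagramCode J₀ d₀ J₁ d₁ W = pair (triple J₀ W d₀) (triple J₁ W d₁)

spanQueriesᵀ : (I a J₀ c₀ J₁ c₁ : Total n) → List (Total n)
spanQueriesᵀ I a J₀ c₀ J₁ c₁ = queryᵀ I a J₀ c₀ ∷ queryᵀ I a J₁ c₁ ∷ []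

diagramQueriesᵀ : (J₀ b₀ c₀ J₁ b₁ c₁ W d₀ d₁ e : Total n) → List (Total n)
diagramQueriesᵀ J₀ b₀ c₀ J₁ b₁ c₁ W d₀ d₁ e =
  queryᵀ J₀ b₀ W d₀ ∷ queryᵀ J₁ b₁ W d₁ ∷ queryᵀ J₀ c₀ W e ∷
  queryᵀ J₀ (appendᵀ b₀ c₀) W (appendᵀ d₀ e) ∷ queryᵀ J₁ (appendᵀ b₁ c₁) W (appendᵀ d₁ e) ∷ []

diagramCodeᵀ : (J₀ d₀ J₁ d₁ W : Total n) → Total n
diagramCodeᵀ J₀ d₀ J₁ d₁ W = pairᵀ (tripleᵀ J₀ W d₀) (tripleᵀ J₁ W d₁)

search : (test output : Total 2) → Program 1
search test output = comp (program output) (mu (program test) ∷ proj 0F ∷ [])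

-- A known zero `z` of the test guarantees halting, but the search stops at the least zero, hence
-- the new witness `y`.
search-halts : ∀ (test output : Total 2) χ s z → value test χ (z ∷ s ∷ []) ≡ 0 →
  ∃[ y ] (value test χ (y ∷ s ∷ []) ≡ 0 ×
          χ ⊢ search test output [ s ∷ [] ]⇓ value output χ (y ∷ s ∷ []))
search-halts test output χ s z found
  with y , zero-at-y , least ← leastZero (λ z → value test χ (z ∷ s ∷ [])) z found =
  y , zero-at-y ,
  ⇓comp (y ∷ s ∷ [])
    (λ { 0F → ⇓mu (λ z z<y → let w , eq = least z z<y in w , run z eq) (run y zero-at-y)
       ; 1F → ⇓proj 0F })
    (halts output χ _)
  where
  run : ∀ z {w} → value test χ (z ∷ s ∷ []) ≡ w → χ ⊢ program test [ z ∷ s ∷ [] ]⇓ w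
  run z eq = subst (χ ⊢ program test [ z ∷ s ∷ [] ]⇓_) eq (halts test χ _)

-- Values of the programs on a given input

module _ (χ : ℕ → Bool) (xs : Vec ℕ n) where

  infix 4 _↦_

  -- A record instead of the bare equation lets unification recover the program `p` and the number
  -- `x`.
  record _↦_ (p : Total n) (x : ℕ) : Set where
    constructor ⟨_⟩
    field value≡ : value p χ xs ≡ x

open _↦_

module _ {χ : ℕ → Bool} {xs : Vec ℕ n} where
  private
    infix 4 _⇝_
    _⇝_ = _↦_ χ xs

  opaque
    unfolding pairᵀ π₁ᵀ π₂ᵀ appendᵀ

    pair-↦ : ∀ {p q x y} → p ⇝ x → q ⇝ y → pairᵀ p q ⇝ pair x y
    pair-↦ ⟨ refl ⟩ ⟨ refl ⟩ = ⟨ refl ⟩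

    π₁-↦ : ∀ {p} x y → p ⇝ pair x y → π₁ᵀ p ⇝ x
    π₁-↦ x y ⟨ eq ⟩ = ⟨ trans (cong π₁ eq) (π₁-pair x y) ⟩

    π₂-↦ : ∀ {p} x y → p ⇝ pair x y → π₂ᵀ p ⇝ y
    π₂-↦ x y ⟨ eq ⟩ = ⟨ trans (cong π₂ eq) (π₂-pair x y) ⟩

    append-↦ : ∀ {p q x y} → p ⇝ x → q ⇝ y → appendᵀ p q ⇝ append x y
    append-↦ ⟨ refl ⟩ ⟨ refl ⟩ = ⟨ refl ⟩

  triple-↦ : ∀ {p q r x y z} → p ⇝ x → q ⇝ y → r ⇝ z → tripleᵀ p q r ⇝ triple x y z
  triple-↦ p↦x q↦y r↦z = pair-↦ p↦x (pair-↦ q↦y r↦z)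

  query-↦ : ∀ {p q r t x y z u} → p ⇝ x → q ⇝ y → r ⇝ z → t ⇝ u → queryᵀ p q r t ⇝ query x y z u
  query-↦ p↦x q↦y r↦z t↦u = pair-↦ p↦x (triple-↦ q↦y r↦z t↦u)

  accepting-yes : ∀ {qs ys} p r → Pointwise _⇝_ qs ys → All (T ∘ χ) ys →
                  value (accepting qs p r) χ xs ≡ value p χ xs
  accepting-yes p r []                            []       = refl
  accepting-yes p r (_∷_ {x = q} ⟨ refl ⟩ qs↦ys) (_ ∷ as)
    with true ← χ (value q χ xs) = accepting-yes p r qs↦ys as

  -- No rejected query has to be exhibited: as long as queries are accepted, the refutation passes
  -- to the remaining ones.
  accepting-no : ∀ {qs ys} p r → Pointwise _⇝_ qs ys → ¬ All (T ∘ χ) ys →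
                 value (accepting qs p r) χ xs ≡ value r χ xs
  accepting-no p r []                            rej = contradiction [] rej
  accepting-no p r (_∷_ {x = q} ⟨ refl ⟩ qs↦ys) rej with χ (value q χ xs) in eq
  ... | false = refl
  ... | true  = accepting-no p r qs↦ys λ as → rej (subst T (sym eq) _ ∷ as)

  spanQueries-↦ : ∀ {I a J₀ c₀ J₁ c₁ i a′ j₀ c₀′ j₁ c₁′} →
    I ⇝ i → a ⇝ a′ → J₀ ⇝ j₀ → c₀ ⇝ c₀′ → J₁ ⇝ j₁ → c₁ ⇝ c₁′ →
    Pointwise _⇝_ (spanQueriesᵀ I a J₀ c₀ J₁ c₁) (spanQueries i a′ j₀ c₀′ j₁ c₁′)
  spanQueries-↦ I a J₀ c₀ J₁ c₁ =
    query-↦ I a J₀ c₀ ∷ query-↦ I a J₁ c₁ ∷ []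

  diagramQueries-↦ : ∀ {J₀ b₀ c₀ J₁ b₁ c₁ W d₀ d₁ e j₀ b₀′ c₀′ j₁ b₁′ c₁′ w d₀′ d₁′ e′} →
    J₀ ⇝ j₀ → b₀ ⇝ b₀′ → c₀ ⇝ c₀′ → J₁ ⇝ j₁ → b₁ ⇝ b₁′ → c₁ ⇝ c₁′ →
    W ⇝ w → d₀ ⇝ d₀′ → d₁ ⇝ d₁′ → e ⇝ e′ →
    Pointwise _⇝_ (diagramQueriesᵀ J₀ b₀ c₀ J₁ b₁ c₁ W d₀ d₁ e)
      (diagramQueries j₀ b₀′ c₀′ j₁ b₁′ c₁′ w d₀′ d₁′ e′)
  diagramQueries-↦ J₀ b₀ c₀ J₁ b₁ c₁ W d₀ d₁ e =
    query-↦ J₀ b₀ W d₀ ∷ query-↦ J₁ b₁ W d₁ ∷ query-↦ J₀ c₀ W e ∷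
    query-↦ J₀ (append-↦ b₀ c₀) W (append-↦ d₀ e) ∷
    query-↦ J₁ (append-↦ b₁ c₁) W (append-↦ d₁ e) ∷ []

  diagramCode-↦ : ∀ {J₀ d₀ J₁ d₁ W j₀ d₀′ j₁ d₁′ w} →
    J₀ ⇝ j₀ → d₀ ⇝ d₀′ → J₁ ⇝ j₁ → d₁ ⇝ d₁′ → W ⇝ w →
    diagramCodeᵀ J₀ d₀ J₁ d₁ W ⇝ diagramCode j₀ d₀′ j₁ d₁′ w
  diagramCode-↦ J₀ d₀ J₁ d₁ W = pair-↦ (triple-↦ J₀ W d₀) (triple-↦ J₁ W d₁)

-- The second argument is the code of a potential span, the first one a
-- candidate (W , d₀ , d₁ , e).
module Amalgamation where

  zᵀ sᵀ Iᵀ aᵀ J₀ᵀ b₀ᵀ c₀ᵀ J₁ᵀ b₁ᵀ c₁ᵀ Wᵀ d₀ᵀ d₁ᵀ eᵀ : Total 2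
  zᵀ  = projᵀ 0F
  sᵀ  = projᵀ 1F
  Iᵀ  = π₁ᵀ (π₁ᵀ sᵀ)
  -- The first component of `𝕀 i` is the code of the generators `𝐚 i`, so they can be read off the
  -- input; likewise for `b₀ᵀ` and `b₁ᵀ`.
  aᵀ  = π₁ᵀ Iᵀ
  J₀ᵀ = π₁ᵀ (π₂ᵀ (π₁ᵀ sᵀ))
  b₀ᵀ = π₁ᵀ J₀ᵀ
  c₀ᵀ = π₂ᵀ (π₂ᵀ (π₁ᵀ sᵀ))
  J₁ᵀ = π₁ᵀ (π₂ᵀ (π₂ᵀ sᵀ))
  b₁ᵀ = π₁ᵀ J₁ᵀ
  c₁ᵀ = π₂ᵀ (π₂ᵀ (π₂ᵀ sᵀ))
  Wᵀ  = π₁ᵀ zᵀ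
  d₀ᵀ = π₁ᵀ (π₂ᵀ zᵀ)
  d₁ᵀ = π₁ᵀ (π₂ᵀ (π₂ᵀ zᵀ))
  eᵀ  = π₂ᵀ (π₂ᵀ (π₂ᵀ zᵀ))

  spans diagrams : List (Total 2)
  spans    = spanQueriesᵀ Iᵀ aᵀ J₀ᵀ c₀ᵀ J₁ᵀ c₁ᵀ
  diagrams = diagramQueriesᵀ J₀ᵀ b₀ᵀ c₀ᵀ J₁ᵀ b₁ᵀ c₁ᵀ Wᵀ d₀ᵀ d₁ᵀ eᵀ

  found default : Total 2
  found   = diagramCodeᵀ J₀ᵀ d₀ᵀ J₁ᵀ d₁ᵀ Wᵀ
  -- The codomain is that of `F₀`, whose generators are sent to themselves; 0 is the code of the
  -- empty tuple.
  default = diagramCodeᵀ J₀ᵀ b₀ᵀ J₁ᵀ zeroᵀ J₀ᵀ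

  verdict test output : Total 2
  -- The search stops where `test` is 0. On a span this requires all diagram queries to be accepted;
  -- otherwise `test` vanishes everywhere and the search stops at once.
  verdict = accepting diagrams zeroᵀ (sucᵀ zeroᵀ)
  test    = accepting spans verdict zeroᵀ
  output  = accepting spans found default

  -- The codes are replaced by arbitrary numbers with equations giving their shape; `r`, `r₀`, `r₁`
  -- stand for what follows the generators in `𝕀`.
  module OnSpan
           {χ : ℕ → Bool} {s I J₀ c₀ J₁ c₁ : ℕ} (s≡ : s ≡ pair (triple I J₀ c₀) (triple I J₁ c₁))
           (a r : ℕ) (I≡ : I ≡ pair a r) (b₀ r₀ : ℕ) (J₀≡ : J₀ ≡ pair b₀ r₀)
           (b₁ r₁ : ℕ) (J₁≡ : J₁ ≡ pair b₁ r₁) where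

    module _ (z : ℕ) where
      private
        infix 4 _⇝_
        _⇝_ = _↦_ χ (z ∷ s ∷ [])

        F₀⇝ : π₁ᵀ sᵀ ⇝ triple I J₀ c₀
        F₀⇝ = π₁-↦ (triple I J₀ c₀) (triple I J₁ c₁) ⟨ s≡ ⟩
        F₁⇝ : π₂ᵀ sᵀ ⇝ triple I J₁ c₁
        F₁⇝ = π₂-↦ (triple I J₀ c₀) (triple I J₁ c₁) ⟨ s≡ ⟩
        I⇝ : Iᵀ ⇝ I
        I⇝ = π₁-↦ I (pair J₀ c₀) F₀⇝
        a⇝ : aᵀ ⇝ a
        a⇝ = π₁-↦ a r (subst (Iᵀ ⇝_) I≡ I⇝)
        J₀⇝ : J₀ᵀ ⇝ J₀
        J₀⇝ = π₁-↦ J₀ c₀ (π₂-↦ I (pair J₀ c₀) F₀⇝)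
        b₀⇝ : b₀ᵀ ⇝ b₀
        b₀⇝ = π₁-↦ b₀ r₀ (subst (J₀ᵀ ⇝_) J₀≡ J₀⇝)
        c₀⇝ : c₀ᵀ ⇝ c₀
        c₀⇝ = π₂-↦ J₀ c₀ (π₂-↦ I (pair J₀ c₀) F₀⇝)
        J₁⇝ : J₁ᵀ ⇝ J₁
        J₁⇝ = π₁-↦ J₁ c₁ (π₂-↦ I (pair J₁ c₁) F₁⇝)
        b₁⇝ : b₁ᵀ ⇝ b₁
        b₁⇝ = π₁-↦ b₁ r₁ (subst (J₁ᵀ ⇝_) J₁≡ J₁⇝)
        c₁⇝ : c₁ᵀ ⇝ c₁
        c₁⇝ = π₂-↦ J₁ c₁ (π₂-↦ I (pair J₁ c₁) F₁⇝)

      spans-↦ : Pointwise _⇝_ spans (spanQueries I a J₀ c₀ J₁ c₁)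
      spans-↦ = spanQueries-↦ I⇝ a⇝ J₀⇝ c₀⇝ J₁⇝ c₁⇝

      diagrams-↦ : ∀ {W d₀ d₁ e} → Wᵀ ⇝ W → d₀ᵀ ⇝ d₀ → d₁ᵀ ⇝ d₁ → eᵀ ⇝ e →
                   Pointwise _⇝_ diagrams (diagramQueries J₀ b₀ c₀ J₁ b₁ c₁ W d₀ d₁ e)
      diagrams-↦ = diagramQueries-↦ J₀⇝ b₀⇝ c₀⇝ J₁⇝ b₁⇝ c₁⇝

      found-↦ : ∀ {W d₀ d₁} → Wᵀ ⇝ W → d₀ᵀ ⇝ d₀ → d₁ᵀ ⇝ d₁ → found ⇝ diagramCode J₀ d₀ J₁ d₁ W
      found-↦ W d₀ d₁ = diagramCode-↦ J₀⇝ d₀ J₁⇝ d₁ W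

      default-↦ : default ⇝ diagramCode J₀ b₀ J₁ 0 J₀
      default-↦ = diagramCode-↦ J₀⇝ b₀⇝ J₁⇝ ⟨ refl ⟩ J₀⇝

    diagrams-candidate : ∀ W d₀ d₁ e → Pointwise (_↦_ χ (pair W (triple d₀ d₁ e) ∷ s ∷ [])) diagrams
                           (diagramQueries J₀ b₀ c₀ J₁ b₁ c₁ W d₀ d₁ e)
    diagrams-candidate W d₀ d₁ e = diagrams-↦ _
      (π₁-↦ W (triple d₀ d₁ e) ⟨ refl ⟩)
      (π₁-↦ d₀ (pair d₁ e) ⇝₁)
      (π₁-↦ d₁ e ⇝₂)
      (π₂-↦ d₁ e ⇝₂)
      where
      ⇝₁ = π₂-↦ W (triple d₀ d₁ e) ⟨ refl ⟩
      ⇝₂ = π₂-↦ d₀ (pair d₁ e) ⇝₁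

    Spans Found : Set
    Spans = All (T ∘ χ) (spanQueries I a J₀ c₀ J₁ c₁)

    Diagrams : (W d₀ d₁ e : ℕ) → Set
    Diagrams W d₀ d₁ e = All (T ∘ χ) (diagramQueries J₀ b₀ c₀ J₁ b₁ c₁ W d₀ d₁ e)

    Found = ∃[ W ] ∃[ d₀ ] ∃[ d₁ ] ∃[ e ]
      (Diagrams W d₀ d₁ e × χ ⊢ search test output [ s ∷ [] ]⇓ diagramCode J₀ d₀ J₁ d₁ W)

    private
      valueAt : ℕ → Total 2 → ℕ
      valueAt y p = value p χ (y ∷ s ∷ [])

      -- The search may stop at a different candidate from the one known to exist. Had the oracle
      -- rejected a diagram query there, `test` would be 1 and not 0.
      stopped : Spans → ∀ y → value test χ (y ∷ s ∷ []) ≡ 0 →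
                χ ⊢ search test output [ s ∷ [] ]⇓ value output χ (y ∷ s ∷ []) →
                Dec (Diagrams (valueAt y Wᵀ) (valueAt y d₀ᵀ) (valueAt y d₁ᵀ) (valueAt y eᵀ)) → Found
      stopped isSpan y test≡0 run (no rejected) = contradiction
        (trans (sym test≡0) (trans (accepting-yes verdict zeroᵀ (spans-↦ y) isSpan)
          (accepting-no zeroᵀ (sucᵀ zeroᵀ) (diagrams-↦ y ⟨ refl ⟩ ⟨ refl ⟩ ⟨ refl ⟩ ⟨ refl ⟩) rejected)))
        λ ()
      stopped isSpan y test≡0 run (yes accepted) =
        valueAt y Wᵀ , valueAt y d₀ᵀ , valueAt y d₁ᵀ , valueAt y eᵀ , accepted ,
        subst (χ ⊢ search test output [ s ∷ [] ]⇓_)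
          (trans (accepting-yes found default (spans-↦ y) isSpan)
                 (value≡ (found-↦ y ⟨ refl ⟩ ⟨ refl ⟩ ⟨ refl ⟩)))
          run

    finds : Spans → ∃[ W ] ∃[ d₀ ] ∃[ d₁ ] ∃[ e ] Diagrams W d₀ d₁ e → Found
    finds isSpan (W , d₀ , d₁ , e , qs) =
      let y , test≡0 , run = search-halts test output χ s (pair W (triple d₀ d₁ e))
            (trans (accepting-yes verdict zeroᵀ (spans-↦ (pair W (triple d₀ d₁ e))) isSpan)
                   (accepting-yes zeroᵀ (sucᵀ zeroᵀ) (diagrams-candidate W d₀ d₁ e) qs))
      in stopped isSpan y test≡0 run (all? (λ q → T? (χ q)) _)

    defaults : ¬ Spans → χ ⊢ search test output [ s ∷ [] ]⇓ diagramCode J₀ b₀ J₁ 0 J₀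
    defaults notSpan =
      -- Without a span every candidate makes `test` vanish, in particular 0.
      let y , _ , run = search-halts test output χ s 0 (accepting-no verdict zeroᵀ (spans-↦ 0) notSpan)
      in subst (χ ⊢ search test output [ s ∷ [] ]⇓_)
           (trans (accepting-no found default (spans-↦ y) notSpan) (value≡ (default-↦ y))) run

-- Reading the embedding information

module _ {L : Language} {ℓ : Level} {K : Age L ℓ} (𝕂 : ComputableAge K) where
  open ComputableAge 𝕂
  open Embedding using (map; congruent)
  open PotentialEmbedding using (IsEmbedding; encoded)

  private
    EI = EmbeddingInformation 𝕂

    index : ℕ → ℕ
    index i = ComputableStructure.index (𝒜 i)

    TupleIn : ℕ → Set
    TupleIn k = Tuple (Structure.Carrier (𝒮 k))

  -- The index is itself a component of the coded triple.
  𝕀-injective : ∀ {i j} → 𝕀 i ≡ 𝕀 j → i ≡ j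
  𝕀-injective {i} {j} eq = proj₂ (pair-injective (index i) i (index j) j
    (proj₂ (pair-injective (codeTuple (𝐚 i)) (pair (index i) i)
                           (codeTuple (𝐚 j)) (pair (index j) j) eq)))

  similar-code : ∀ {k₀ k₀′ k₁ k₁′}
    (b₀ : TupleIn k₀) (b₀′ : TupleIn k₀′) (b₁ : TupleIn k₁) (b₁′ : TupleIn k₁′) →
    k₀ ≡ k₀′ → codeTuple b₀ ≡ codeTuple b₀′ → k₁ ≡ k₁′ → codeTuple b₁ ≡ codeTuple b₁′ →
    Similar (𝒮 k₀) (𝒮 k₁) b₀ b₁ → Similar (𝒮 k₀′) (𝒮 k₁′) b₀′ b₁′
  similar-code b₀ b₀′ b₁ b₁′ refl eq₀ refl eq₁ =
    similar-resp {A = 𝒮 _} {B = 𝒮 _} b₀ b₀′ b₁ b₁′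
      (codeTuple-injective b₀ b₀′ eq₀) (codeTuple-injective b₁ b₁′ eq₁)

  -- The search yields bare numbers `W` and `d`; a positive oracle answer is what turns them into
  -- codes of a structure and of a tuple in it.
  EI-decode : ∀ k₀ (b₀ : TupleIn k₀) W d → EI (query (𝕀 k₀) (codeTuple b₀) W d) →
    ∃[ k₁ ] Σ[ b₁ ∈ TupleIn k₁ ] (W ≡ 𝕀 k₁ × d ≡ codeTuple b₁ × Similar (𝒮 k₀) (𝒮 k₁) b₀ b₁)
  EI-decode k₀ b₀ W d (k₀′ , b₀′ , k₁ , b₁ , eq , sim) =
    let eqI , eq′  = pair-injective (𝕀 k₀) (triple (codeTuple b₀) W d)
                       (𝕀 k₀′) (triple (codeTuple b₀′) (𝕀 k₁) (codeTuple b₁)) eq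
        eqb , eq″  = pair-injective (codeTuple b₀) (pair W d)
                       (codeTuple b₀′) (pair (𝕀 k₁) (codeTuple b₁)) eq′
        eqW , eqd  = pair-injective W d (𝕀 k₁) (codeTuple b₁) eq″
    in k₁ , b₁ , eqW , eqd ,
       similar-code b₀′ b₀ b₁ b₁ (sym (𝕀-injective {k₀} {k₀′} eqI)) (sym eqb) refl refl sim

  -- Keeps `k₁` fixed, so that the tuples decoded from different queries lie in one structure.
  EI-decodeAt : ∀ k₀ (b₀ : TupleIn k₀) k₁ W d → W ≡ 𝕀 k₁ →
    EI (query (𝕀 k₀) (codeTuple b₀) W d) →
    Σ[ b₁ ∈ TupleIn k₁ ] (d ≡ codeTuple b₁ × Similar (𝒮 k₀) (𝒮 k₁) b₀ b₁)
  EI-decodeAt k₀ b₀ k₁ W d W≡ ei =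
    let k₁′ , b₁ , W≡′ , d≡ , sim = EI-decode k₀ b₀ W d ei
    in reindex b₁ (𝕀-injective {k₁′} {k₁} (trans (sym W≡′) W≡)) d≡ sim
    where
    reindex : ∀ {k₁′} (b₁ : TupleIn k₁′) → k₁′ ≡ k₁ → d ≡ codeTuple b₁ →
              Similar (𝒮 k₀) (𝒮 k₁′) b₀ b₁ →
              Σ[ b₁ ∈ TupleIn k₁ ] (d ≡ codeTuple b₁ × Similar (𝒮 k₀) (𝒮 k₁) b₀ b₁)
    reindex b₁ refl d≡ sim = b₁ , d≡ , sim

  EI-sound : ∀ k₀ (b₀ : TupleIn k₀) k₁ (b₁ : TupleIn k₁) →
    EI (query (𝕀 k₀) (codeTuple b₀) (𝕀 k₁) (codeTuple b₁)) → Similar (𝒮 k₀) (𝒮 k₁) b₀ b₁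
  EI-sound k₀ b₀ k₁ b₁ ei =
    let b₁′ , eqb , sim = EI-decodeAt k₀ b₀ k₁ (𝕀 k₁) (codeTuple b₁) refl ei
    in similar-code b₀ b₀ b₁′ b₁ refl refl refl (sym eqb) sim

  EI-complete : ∀ k₀ (b₀ : TupleIn k₀) k₁ (b₁ : TupleIn k₁) →
    Similar (𝒮 k₀) (𝒮 k₁) b₀ b₁ → EI (query (𝕀 k₀) (codeTuple b₀) (𝕀 k₁) (codeTuple b₁))
  EI-complete k₀ b₀ k₁ b₁ sim = k₀ , b₀ , k₁ , b₁ , refl , sim

  EI-⊕ : ∀ k₀ (b₀ c₀ : TupleIn k₀) k₁ (b₁ c₁ : TupleIn k₁) →
    EI (query (𝕀 k₀) (append (codeTuple b₀) (codeTuple c₀))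
              (𝕀 k₁) (append (codeTuple b₁) (codeTuple c₁))) ⇔
    Similar (𝒮 k₀) (𝒮 k₁) (b₀ ⊕ c₀) (b₁ ⊕ c₁)
  EI-⊕ k₀ b₀ c₀ k₁ b₁ c₁ = mk⇔
    (λ ei → EI-sound k₀ (b₀ ⊕ c₀) k₁ (b₁ ⊕ c₁) (subst EI eq ei))
    (λ sim → subst EI (sym eq) (EI-complete k₀ (b₀ ⊕ c₀) k₁ (b₁ ⊕ c₁) sim))
    where
    eq = cong₂ (λ x y → query (𝕀 k₀) x (𝕀 k₁) y) (codeTuple-⊕ b₀ c₀) (codeTuple-⊕ b₁ c₁)

  -- Diagrams over a given potential span

  module _ (S : PotentialSpan 𝕂) where
    open PotentialSpan S using (i; j₀; j₁; F₀; F₁)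
    private
      c₀ = PotentialEmbedding.image F₀
      c₁ = PotentialEmbedding.image F₁

      AcceptedDiagram : (W d₀ d₁ e : ℕ) → Set
      AcceptedDiagram W d₀ d₁ e = All EI
        (diagramQueries (𝕀 j₀) (codeTuple (𝐚 j₀)) (codeTuple c₀)
                        (𝕀 j₁) (codeTuple (𝐚 j₁)) (codeTuple c₁) W d₀ d₁ e)

    -- The first query determines `k`; the next two are decoded over the same `k`, and the two
    -- concatenation queries give commutativity.
    diagram : ∀ W d₀ d₁ e → AcceptedDiagram W d₀ d₁ e →
              Σ[ D ∈ AmalgamationDiagram 𝕂 S ]
                AmalgamationDiagram.code D ≡ diagramCode (𝕀 j₀) d₀ (𝕀 j₁) d₁ W
    diagram W d₀ d₁ e (q₀ ∷ q₁ ∷ q₂ ∷ q₃ ∷ q₄ ∷ []) =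
      let k , d₀′ , W≡ , d₀≡ , h₀ = EI-decode j₀ (𝐚 j₀) W d₀ q₀
          d₁′ , d₁≡ , h₁          = EI-decodeAt j₁ (𝐚 j₁) k W d₁ W≡ q₁
          e′ , e≡ , s             = EI-decodeAt j₀ c₀ k W e W≡ q₂
      in assemble k d₀′ d₁′ e′ W≡ d₀≡ d₁≡ e≡ h₀ h₁ s q₃ q₄
      where
      -- The numbers are generalised so that their equations can be eliminated by matching.
      assemble : ∀ k (d₀′ d₁′ e′ : TupleIn k) {W d₀ d₁ e} →
        W ≡ 𝕀 k → d₀ ≡ codeTuple d₀′ → d₁ ≡ codeTuple d₁′ → e ≡ codeTuple e′ →
        Similar (𝒮 j₀) (𝒮 k) (𝐚 j₀) d₀′ → Similar (𝒮 j₁) (𝒮 k) (𝐚 j₁) d₁′ →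
        Similar (𝒮 j₀) (𝒮 k) c₀ e′ →
        EI (query (𝕀 j₀) (append (codeTuple (𝐚 j₀)) (codeTuple c₀)) W (append d₀ e)) →
        EI (query (𝕀 j₁) (append (codeTuple (𝐚 j₁)) (codeTuple c₁)) W (append d₁ e)) →
        Σ[ D ∈ AmalgamationDiagram 𝕂 S ]
          AmalgamationDiagram.code D ≡ diagramCode (𝕀 j₀) d₀ (𝕀 j₁) d₁ W
      assemble k d₀ d₁ e refl refl refl refl h₀ h₁ s q₃ q₄ = record
        { G₀           = potentialEmbedding d₀
        ; G₁           = potentialEmbedding d₁
        ; G₀-embedding = h₀
        ; amalgamates  = λ f₀ f₁ → h₁ ,
            commutes (𝐚 i) (generates i) (𝐚 j₀) (generates j₀) (𝐚 j₁) (generates j₁)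
              c₀ c₁ d₀ d₁ e f₀ f₁ h₀ h₁ s
              (Equivalence.to (EI-⊕ j₀ (𝐚 j₀) c₀ k d₀ e) q₃)
              (Equivalence.to (EI-⊕ j₁ (𝐚 j₁) c₁ k d₁ e) q₄)
        } , refl

    diagram-exists : AmalgamationProperty K → IsEmbedding F₀ → IsEmbedding F₁ →
                     ∃[ W ] ∃[ d₀ ] ∃[ d₁ ] ∃[ e ] AcceptedDiagram W d₀ d₁ e
    diagram-exists ap f₀ f₁ =
      let D , D∈𝒦 , α₀ , α₁ , square =
            ap (member i) (member j₀) (member j₁) (encoded F₀ f₀) (encoded F₁ f₁)
          -- The amalgam is only some member of the age; `β` moves it into the representation, where
          -- the search can find it.
          k , β , _ = complete D∈𝒦
          d₀ = image (map (β ∘ᵉ α₀)) (𝐚 j₀)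
          d₁ = image (map (β ∘ᵉ α₁)) (𝐚 j₁)
          e  = image (map (β ∘ᵉ α₀)) c₀
          h₀ , h₁ , s , s₀ , s₁ =
            amalgam-similar (𝐚 i) (generates i) (𝐚 j₀) (generates j₀) (𝐚 j₁) (generates j₁)
              c₀ c₁ f₀ f₁ (β ∘ᵉ α₀) (β ∘ᵉ α₁) (λ x → congruent β (square x))
      in 𝕀 k , codeTuple d₀ , codeTuple d₁ , codeTuple e ,
         EI-complete j₀ (𝐚 j₀) k d₀ h₀ ∷ EI-complete j₁ (𝐚 j₁) k d₁ h₁ ∷ EI-complete j₀ c₀ k e s ∷
         Equivalence.from (EI-⊕ j₀ (𝐚 j₀) c₀ k d₀ e) s₀ ∷
         Equivalence.from (EI-⊕ j₁ (𝐚 j₁) c₁ k d₁ e) s₁ ∷ []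

    trivialDiagram : ¬ (IsEmbedding F₀ × IsEmbedding F₁) → AmalgamationDiagram 𝕂 S
    trivialDiagram notSpan = record
      { G₀           = potentialEmbedding (𝐚 j₀)
      -- The empty tuple exists even in an empty structure, and a potential embedding puts no
      -- condition on the length.
      ; G₁           = potentialEmbedding (0 , λ ())
      ; G₀-embedding = similar-refl (𝒮 j₀) (𝐚 j₀)
      ; amalgamates  = λ f₀ f₁ → contradiction (f₀ , f₁) notSpan
      }

    module _ (ap : AmalgamationProperty K) {χ : ℕ → Bool} (isχ : IsCharacteristicFunction χ EI) where
      private
        s = PotentialSpan.code S

        spanQueriesˢ : List ℕ
        spanQueriesˢ = spanQueries (𝕀 i) (codeTuple (𝐚 i))
                                   (𝕀 j₀) (codeTuple c₀) (𝕀 j₁) (codeTuple c₁)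

        accepted : ∀ {qs} → All EI qs → All (T ∘ χ) qs
        accepted = All.map λ {q} → Equivalence.from (isχ q)

        sound : ∀ {qs} → All (T ∘ χ) qs → All EI qs
        sound = All.map λ {q} → Equivalence.to (isχ q)

        module Search = Amalgamation.OnSpan
          {χ} {s} {𝕀 i} {𝕀 j₀} {codeTuple c₀} {𝕀 j₁} {codeTuple c₁} refl
          (codeTuple (𝐚 i)) (pair (index i) i) refl
          (codeTuple (𝐚 j₀)) (pair (index j₀) j₀) refl
          (codeTuple (𝐚 j₁)) (pair (index j₁) j₁) refl

        Outcome : Set
        Outcome = Σ[ D ∈ AmalgamationDiagram 𝕂 S ]
          χ ⊢ search Amalgamation.test Amalgamation.output [ s ∷ [] ]⇓ AmalgamationDiagram.code D

        decided : Dec (All (T ∘ χ) spanQueriesˢ) → Outcome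
        decided (no notSpan) =
          trivialDiagram (λ (f₀ , f₁) → notSpan (accepted
            (EI-complete i (𝐚 i) j₀ c₀ f₀ ∷ EI-complete i (𝐚 i) j₁ c₁ f₁ ∷ []))) ,
          Search.defaults notSpan
        decided (yes isSpan) = spanned (sound isSpan)
          where
          accept : ∃[ W ] ∃[ d₀ ] ∃[ d₁ ] ∃[ e ] AcceptedDiagram W d₀ d₁ e →
                   ∃[ W ] ∃[ d₀ ] ∃[ d₁ ] ∃[ e ] Search.Diagrams W d₀ d₁ e
          accept (W , d₀ , d₁ , e , qs) = W , d₀ , d₁ , e , accepted qs

          found : Search.Found → Outcome
          found (W , d₀ , d₁ , e , qs , run) =
            let D , code≡ = diagram W d₀ d₁ e (sound qs)
            in D , subst (χ ⊢ search Amalgamation.test Amalgamation.output [ s ∷ [] ]⇓_) (sym code≡) run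

          spanned : All EI spanQueriesˢ → Outcome
          spanned (t₀ ∷ t₁ ∷ []) = found (Search.finds isSpan (accept
            (diagram-exists ap (EI-sound i (𝐚 i) j₀ c₀ t₀) (EI-sound i (𝐚 i) j₁ c₁ t₁))))

      outcome : Outcome
      -- The case distinction is on Boolean oracle answers, hence constructive.
      outcome = decided (all? (λ q → T? (χ q)) spanQueriesˢ)

proposition5p25 : ∀ {ℓ} (L : Language) (K : Age L ℓ) (𝕂 : ComputableAge K) →
    AmalgamationProperty K →
    HasComputableAmalgamation 𝕂 (EmbeddingInformation 𝕂)
proposition5p25 L K 𝕂 ap =
  -- One program serves all languages and ages: `𝕂` enters through the oracle and the input code.
  search Amalgamation.test Amalgamation.output , λ χ isχ S → outcome 𝕂 S ap isχ
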